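{- For every fixed $n$ and $m$, every deterministic non-preemptive online algorithm for minimizing total flow time on $m$ identical parallel machines has competitive ratio at least $\Gamma(n,m)$, where $\Gamma(n,m)=\Omega\!\left(n/m^2+\sqrt{n/m}\right)$.
   Context: Online scheduling of jobs on $m$ identical machines; each job $j$ has release time $r_j\ge0$ and processing time $p_j>0$, becomes known only at $r_j$, and the algorithm knows $n$ (the number of jobs) and $m$. Each machine processes at most one job at a time; non-preemptive means a started job runs to completion without interruption. Flow time of $j$ is $C_j-r_j$; objective is total flow time. For this lower bound, $\mathrm{OPT}(J)$ is the minimum total flow time over offline non-preemptive schedules. Competitive ratio at least $\Gamma$ means that for some instance with (at most) $n$ jobs the algorithm's total flow time is at least a constant times $\Gamma\cdot\mathrm{OPT}(J)$.
   Formalization: Times are rational: the algorithms considered take instances with rational release and processing times and start every job at a rational time, so online algorithms that use irrational start times are not covered. -}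

module Defs where

open import Data.Nat using (ℕ; zero; suc)
open import Data.Fin using (Fin)
import Data.Fin as Fin
open import Data.Integer using (+_)
open import Data.Rational using (ℚ; 0ℚ; _+_; _*_; _-_; _≤_; _<_; _/_)
open import Data.Product using (_×_)
open import Data.Sum using (_⊎_)
open import Relation.Binary.PropositionalEquality using (_≡_; _≢_)

ℕ→ℚ : ℕ → ℚ
ℕ→ℚ k = (+ k) / 1

sumFin : (n : ℕ) → (Fin n → ℚ) → ℚ
sumFin zero    f = 0ℚ
sumFin (suc n) f = f Fin.zero + sumFin n (λ i → f (Fin.suc i))

record Job : Set where
  constructor job
  field
    release : ℚ
    proc    : ℚ
open Job public

Instance : ℕ → Set
Instance n = Fin n → Job

ValidInstance : {n : ℕ} → Instance n → Set
ValidInstance {n} J = (j : Fin n) → (0ℚ ≤ release (J j)) × (0ℚ < proc (J j))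

record Schedule (n m : ℕ) : Set where
  constructor sched
  field
    machine : Fin n → Fin m
    start   : Fin n → ℚ
open Schedule public

completion : {n m : ℕ} → Instance n → Schedule n m → Fin n → ℚ
completion J S j = start S j + proc (J j)

Feasible : {n m : ℕ} → Instance n → Schedule n m → Set
Feasible {n} J S =
  ((j : Fin n) → release (J j) ≤ start S j) ×
  ((i j : Fin n) → i ≢ j → machine S i ≡ machine S j →
     (completion J S i ≤ start S j) ⊎ (completion J S j ≤ start S i))

totalFlow : {n m : ℕ} → Instance n → Schedule n m → ℚ
totalFlow {n} J S = sumFin n (λ j → completion J S j - release (J j))

-- A deterministic non-preemptive online algorithm knowing n and m:
-- maps every instance to a schedule, feasible on every valid instance, and
-- non-anticipatory: if two valid instances coincide on all jobs released up
-- to time t, then the two schedules make the same decisions (start time and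
-- machine) for every job started at or before time t in either schedule.
record OnlineAlg (n m : ℕ) : Set where
  field
    run      : Instance n → Schedule n m
    feasible : (J : Instance n) → ValidInstance J → Feasible J (run J)
    online   : (J J' : Instance n) → ValidInstance J → ValidInstance J' →
               (t : ℚ) →
               ((j : Fin n) → (release (J j) ≤ t) ⊎ (release (J' j) ≤ t) → J j ≡ J' j) →
               (j : Fin n) → (start (run J) j ≤ t) ⊎ (start (run J') j ≤ t) →
               (start (run J) j ≡ start (run J') j) × (machine (run J) j ≡ machine (run J') j)
open OnlineAlg public

{-# OPTIONS --safe #-}

-- The adversary releases m big jobs of length 2k at time 0. If the algorithm is
-- slow to start them, their waiting time is already too large. Otherwise many of
-- them, say x, start within k time units of each other; from then on x machines
-- are blocked for k time units, and a stream of unit jobs, m per time unit, piles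
-- up behind them: after l time units at least x l unit jobs are waiting, which
-- costs about x k² / 2. Offline, the big jobs are moved out of the way and the
-- stream is served without delay, at total cost O(m k). Here k ≈ n / m, and the
-- threshold x ≈ max(1, m / √k) balances the two cases.
-- All data of the instance are integral, so the algorithm's start times can be
-- rounded down to integers without losing feasibility.

module Submission where

open import Defs
open import Data.Nat using (ℕ; zero; suc; NonZero; _≥_)
open import Data.Fin using (Fin; toℕ; fromℕ<)
import Data.Fin as Fin
import Data.Fin.Properties as Fin
open import Data.Product using (Σ; ∃; _×_; _,_; proj₁; proj₂)
open import Data.Sum using (_⊎_; inj₁; inj₂)
import Data.Sum as Sum
open import Function using (_∘_)
open import Relation.Nullary using (¬_; Dec; yes; no; contradiction)
open import Relation.Nullary.Decidable using (_×-dec_; ¬?)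
open import Relation.Binary.PropositionalEquality
  using (_≡_; _≢_; refl; sym; trans; cong; cong₂; subst)

-- Finite sums and counts of decidable predicates over `Fin n`.

module Counting where
  open import Data.Nat using (_+_; _*_; _≤_; _<_; z≤n; s≤s; _<?_)
  open import Data.Nat.Properties
  open import Algebra.Properties.CommutativeMonoid.Sum +-0-commutativeMonoid public
    using (sum; sum-cong-≗; ∑-distrib-+; ∑-comm)
  open ≤-Reasoning

  private variable
    n m : ℕ
    P Q R : Fin n → Set

  𝟙 : {A : Set} → Dec A → ℕ
  𝟙 (yes _) = 1
  𝟙 (no _)  = 0

  𝟙-yes : {A : Set} (d : Dec A) → A → 𝟙 d ≡ 1
  𝟙-yes (yes _) _ = refl
  𝟙-yes (no ¬a) a = contradiction a ¬a

  𝟙-no : {A : Set} (d : Dec A) → ¬ A → 𝟙 d ≡ 0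
  𝟙-no (yes a) ¬a = contradiction a ¬a
  𝟙-no (no _)  _  = refl

  sum-mono : {f g : Fin n → ℕ} → (∀ j → f j ≤ g j) → sum f ≤ sum g
  sum-mono {zero}  f≤g = z≤n
  sum-mono {suc n} f≤g = +-mono-≤ (f≤g Fin.zero) (sum-mono (f≤g ∘ Fin.suc))

  sum-const : ∀ n c → sum {n} (λ _ → c) ≡ n * c
  sum-const zero    c = refl
  sum-const (suc n) c = cong (c +_) (sum-const n c)

  term≤sum : (f : Fin n → ℕ) (j : Fin n) → f j ≤ sum f
  term≤sum f Fin.zero    = m≤m+n _ _
  term≤sum f (Fin.suc j) = ≤-trans (term≤sum (f ∘ Fin.suc) j) (m≤n+m _ _)

  sum-*ʳ : (f : Fin n → ℕ) (c : ℕ) → sum (λ j → f j * c) ≡ sum f * c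
  sum-*ʳ {zero}  f c = refl
  sum-*ʳ {suc n} f c = trans (cong (f Fin.zero * c +_) (sum-*ʳ (f ∘ Fin.suc) c))
                             (sym (*-distribʳ-+ c (f Fin.zero) _))

  count : ((j : Fin n) → Dec (P j)) → ℕ
  count P? = sum (λ j → 𝟙 (P? j))

  count-none : (P? : (j : Fin n) → Dec (P j)) → (∀ j → ¬ P j) → count P? ≡ 0
  count-none {zero}  P? ¬P = refl
  count-none {suc n} P? ¬P = cong₂ _+_ (𝟙-no (P? Fin.zero) (¬P Fin.zero))
                                       (count-none (P? ∘ Fin.suc) (¬P ∘ Fin.suc))

  count-mono : (P? : (j : Fin n) → Dec (P j)) (Q? : ∀ j → Dec (Q j)) →
               (∀ j → P j → Q j) → count P? ≤ count Q?
  count-mono P? Q? P⊆Q = sum-mono pointwise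
    where
    pointwise : ∀ j → 𝟙 (P? j) ≤ 𝟙 (Q? j)
    pointwise j with P? j
    ... | no _  = z≤n
    ... | yes p = ≤-reflexive (sym (𝟙-yes (Q? j) (P⊆Q j p)))

  count-∪ : (P? : (j : Fin n) → Dec (P j)) (Q? : ∀ j → Dec (Q j)) (R? : ∀ j → Dec (R j)) →
            (∀ j → P j → Q j ⊎ R j) → count P? ≤ count Q? + count R?
  count-∪ P? Q? R? P⊆Q∪R = ≤-trans (sum-mono pointwise) (≤-reflexive (∑-distrib-+ (𝟙 ∘ Q?) (𝟙 ∘ R?)))
    where
    pointwise : ∀ j → 𝟙 (P? j) ≤ 𝟙 (Q? j) + 𝟙 (R? j)
    pointwise j with P? j
    ... | no _  = z≤n
    ... | yes p with P⊆Q∪R j p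
    ...   | inj₁ q rewrite 𝟙-yes (Q? j) q = s≤s z≤n
    ...   | inj₂ r rewrite 𝟙-yes (R? j) r = m≤n+m 1 (𝟙 (Q? j))

  count-⊎ : (P? : (j : Fin n) → Dec (P j)) (Q? : ∀ j → Dec (Q j)) (R? : ∀ j → Dec (R j)) →
            (∀ j → P j → R j) → (∀ j → Q j → R j) → (∀ j → P j → ¬ Q j) →
            count P? + count Q? ≤ count R?
  count-⊎ P? Q? R? P⊆R Q⊆R P∩Q=∅ =
    ≤-trans (≤-reflexive (sym (∑-distrib-+ (𝟙 ∘ P?) (𝟙 ∘ Q?)))) (sum-mono pointwise)
    where
    pointwise : ∀ j → 𝟙 (P? j) + 𝟙 (Q? j) ≤ 𝟙 (R? j)
    pointwise j with P? j | Q? j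
    ... | yes p | yes q = contradiction q (P∩Q=∅ j p)
    ... | yes p | no _  = ≤-reflexive (sym (𝟙-yes (R? j) (P⊆R j p)))
    ... | no _  | yes q = ≤-reflexive (sym (𝟙-yes (R? j) (Q⊆R j q)))
    ... | no _  | no _  = z≤n

  -- Each index in `P` adds one unit of growth. This later integrates the number of waiting jobs
  -- over time.
  count-step : (P? : (j : Fin n) → Dec (P j)) (f g : Fin n → ℕ) →
               (∀ j → f j ≤ g j) → (∀ j → P j → f j < g j) →
               count P? + sum f ≤ sum g
  count-step P? f g f≤g f<g =
    ≤-trans (≤-reflexive (sym (∑-distrib-+ (𝟙 ∘ P?) f))) (sum-mono pointwise)
    where
    pointwise : ∀ j → 𝟙 (P? j) + f j ≤ g j
    pointwise j with P? j
    ... | yes p = f<g j p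
    ... | no _  = f≤g j

  count*≤sum : (P? : (j : Fin n) → Dec (P j)) (g : Fin n → ℕ) (c : ℕ) →
               (∀ j → P j → c ≤ g j) → count P? * c ≤ sum g
  count*≤sum P? g c c≤g = ≤-trans (≤-reflexive (sym (sum-*ʳ (𝟙 ∘ P?) c))) (sum-mono pointwise)
    where
    pointwise : ∀ j → 𝟙 (P? j) * c ≤ g j
    pointwise j with P? j
    ... | yes p = ≤-trans (≤-reflexive (+-identityʳ c)) (c≤g j p)
    ... | no _  = z≤n

  sum≤count* : (P? : (j : Fin n) → Dec (P j)) (g : Fin n → ℕ) (a b : ℕ) →
               (∀ j → P j → g j ≤ a) → (∀ j → ¬ P j → g j ≤ b) →
               sum g ≤ count P? * a + n * b
  sum≤count* {n = n} P? g a b g≤a g≤b = begin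
    sum g                                          ≤⟨ sum-mono pointwise ⟩
    sum (λ j → 𝟙 (P? j) * a + b)                   ≡⟨ ∑-distrib-+ (λ j → 𝟙 (P? j) * a) (λ _ → b) ⟩
    sum (λ j → 𝟙 (P? j) * a) + sum {n} (λ _ → b)   ≡⟨ cong₂ _+_ (sum-*ʳ (𝟙 ∘ P?) a) (sum-const n b) ⟩
    count P? * a + n * b                           ∎
    where
    pointwise : ∀ j → g j ≤ 𝟙 (P? j) * a + b
    pointwise j with P? j
    ... | yes p = ≤-trans (g≤a j p) (≤-trans (m≤m+n a 0) (m≤m+n (a + 0) b))
    ... | no ¬p = g≤b j ¬p

  count-unique : (P? : (j : Fin n) → Dec (P j)) → (∀ i j → P i → P j → i ≡ j) → count P? ≤ 1
  count-unique {zero}  P? unique = z≤n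
  count-unique {suc n} P? unique with P? Fin.zero
  ... | no _  = count-unique (P? ∘ Fin.suc) λ i j p q → Fin.suc-injective (unique _ _ p q)
  ... | yes p = ≤-reflexive (cong suc (count-none (P? ∘ Fin.suc) λ j q → Fin.0≢1+n (unique _ _ p q)))

  -- Double counting: each index in `P` lies in the fibre of its own image, and injectivity on `P`
  -- leaves at most one element per fibre.
  count-injective : (P? : (j : Fin n) → Dec (P j)) (φ : Fin n → Fin m) →
                    (∀ i j → P i → P j → φ i ≡ φ j → i ≡ j) → count P? ≤ m
  count-injective {n = n} {m = m} P? φ inj = begin
    count P?                                      ≤⟨ sum-mono pointwise ⟩
    sum (λ j → sum (λ i → 𝟙 (fibre? i j)))        ≡⟨ ∑-comm (λ j i → 𝟙 (fibre? i j)) ⟩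
    sum (λ i → count (fibre? i))                  ≤⟨ sum-mono (λ i → count-unique (fibre? i)
                                                       λ _ _ p q → inj _ _ (proj₁ p) (proj₁ q)
                                                         (trans (proj₂ p) (sym (proj₂ q)))) ⟩
    sum {m} (λ _ → 1)                             ≡⟨ sum-const m 1 ⟩
    m * 1                                         ≡⟨ *-identityʳ m ⟩
    m                                             ∎
    where
    fibre? : ∀ i j → Dec (_ × φ j ≡ i)
    fibre? i j = P? j ×-dec (φ j Fin.≟ i)
    pointwise : ∀ j → 𝟙 (P? j) ≤ sum (λ i → 𝟙 (fibre? i j))
    pointwise j with P? j in eq
    ... | no _  = z≤n
    ... | yes p = begin
      1                          ≡⟨ 𝟙-yes (fibre? (φ j) j) (p , refl) ⟨
      𝟙 (fibre? (φ j) j)         ≤⟨ term≤sum (λ i → 𝟙 (fibre? i j)) (φ j) ⟩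
      sum (λ i → 𝟙 (fibre? i j)) ≡⟨ cong (λ d → sum (λ i → 𝟙 (d ×-dec (φ j Fin.≟ i)))) eq ⟩
      _                          ∎

  count-toℕ< : ∀ {a} → a ≤ n → count {n} (λ j → toℕ j <? a) ≡ a
  count-toℕ< {n}     {zero}  _         = count-none (λ (j : Fin n) → toℕ j <? 0) λ _ ()
  count-toℕ< {suc n} {suc a} (s≤s a≤n) =
    cong suc (trans (sum-cong-≗ (λ (j : Fin n) → shift (toℕ j))) (count-toℕ< a≤n))
    where
    shift : ∀ i → 𝟙 (suc i <? suc a) ≡ 𝟙 (i <? a)
    shift i with i <? a
    ... | yes i<a = 𝟙-yes (suc i <? suc a) (s≤s i<a)
    ... | no i≮a  = 𝟙-no (suc i <? suc a) (i≮a ∘ ≤-pred)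

-- The adversary's instances, in natural numbers.

module Adversary where
  open import Data.Nat using (_+_; _*_; _∸_; _⊓_; _≤_; _<_; z≤n; s≤s; _≤?_; _<?_; _/_; _%_;
    >-nonZero; >-nonZero⁻¹)
  open import Data.Nat.Properties
  open import Data.Nat.DivMod
  open import Data.Nat.Tactic.RingSolver using (solve-∀)
  open Counting
  open ≤-Reasoning

  -- Jobs are indexed by i < n; the first m of them are the big ones.
  ifBig : (m b s i : ℕ) → ℕ
  ifBig m b s i with i <? m
  ... | yes _ = b
  ... | no _  = s

  -- Small jobs have `i / m ≥ 1`, so they come in batches of up to `m`, the first at `τ + 1`. Up to
  -- time `τ` only big jobs are visible, whatever `τ` is.
  releaseTime : (m τ i : ℕ) .{{_ : NonZero m}} → ℕ
  releaseTime m τ i = ifBig m 0 (τ + i / m) i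

  procTime : (m k i : ℕ) → ℕ
  procTime m k i = ifBig m (2 * k) 1 i

  record Feasibleℕ {n m : ℕ} (r p f : Fin n → ℕ) (μ : Fin n → Fin m) : Set where
    field
      released : ∀ j → r j ≤ f j
      disjoint : ∀ i j → i ≢ j → μ i ≡ μ j → (f i + p i ≤ f j) ⊎ (f j + p j ≤ f i)

  module _ {m b s i : ℕ} where
    ifBig-big : i < m → ifBig m b s i ≡ b
    ifBig-big i<m with i <? m
    ... | yes _  = refl
    ... | no i≮m = contradiction i<m i≮m

    ifBig-small : ¬ i < m → ifBig m b s i ≡ s
    ifBig-small i≮m with i <? m
    ... | yes i<m = contradiction i<m i≮m
    ... | no _    = refl

  module _ {m k i : ℕ} where
    procTime-big : i < m → procTime m k i ≡ 2 * k
    procTime-big = ifBig-big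

    procTime-small : ¬ i < m → procTime m k i ≡ 1
    procTime-small = ifBig-small

  module _ {m τ i : ℕ} .{{_ : NonZero m}} where
    releaseTime-big : i < m → releaseTime m τ i ≡ 0
    releaseTime-big = ifBig-big

    releaseTime-small : ¬ i < m → releaseTime m τ i ≡ τ + i / m
    releaseTime-small = ifBig-small

    τ<releaseTime-small : ¬ i < m → τ < releaseTime m τ i
    τ<releaseTime-small i≮m = begin-strict
      τ                 <⟨ m<m+n τ (m≥n⇒m/n>0 (≮⇒≥ i≮m)) ⟩
      τ + i / m         ≡⟨ releaseTime-small i≮m ⟨
      releaseTime m τ i ∎

  module _ {n m : ℕ} {r p f : Fin n → ℕ} {μ : Fin n → Fin m} (feasible : Feasibleℕ r p f μ) where
    open Feasibleℕ feasible

    running? : ∀ v j → Dec (f j ≤ v × v < f j + p j)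
    running? v j = (f j ≤? v) ×-dec (v <? f j + p j)

    -- Two jobs running at the same `v` on one machine would contradict `disjoint`, so `μ` is
    -- injective on the running jobs.
    count-running≤machines : ∀ v → count (running? v) ≤ m
    count-running≤machines v = count-injective (running? v) μ inj
      where
      inj : ∀ i j → f i ≤ v × v < f i + p i → f j ≤ v × v < f j + p j → μ i ≡ μ j → i ≡ j
      inj i j (fi≤v , v<ci) (fj≤v , v<cj) μi≡μj with i Fin.≟ j
      ... | yes i≡j = i≡j
      ... | no i≢j  with disjoint i j i≢j μi≡μj
      ...   | inj₁ ci≤fj = contradiction (<-≤-trans v<ci (≤-trans ci≤fj fj≤v)) (<-irrefl refl)
      ...   | inj₂ cj≤fi = contradiction (<-≤-trans v<cj (≤-trans cj≤fi fi≤v)) (<-irrefl refl)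

  -- Case of a crowded window: the stream piles up.

  big? : {n : ℕ} (m : ℕ) (j : Fin n) → Dec (toℕ j < m)
  big? m j = toℕ j <? m

  -- The window has half the length of a big job, so a big job starting in it runs throughout the
  -- next `k` time units. The end is written `k + a` because for `a = i * k` this is `suc i * k` by
  -- definition.
  window? : {n : ℕ} (m k a : ℕ) (f : Fin n → ℕ) (j : Fin n) →
            Dec (toℕ j < m × a ≤ f j × f j < k + a)
  window? m k a f j = big? m j ×-dec (a ≤? f j) ×-dec (f j <? k + a)

  -- If x big jobs start during [a , k + a), they block x machines throughout
  -- [τ , τ + k) with τ = k + a, while m unit jobs arrive per unit of time.
  module Blocked {n m k a x : ℕ} .{{_ : NonZero m}} {f : Fin n → ℕ} {μ : Fin n → Fin m}
    (feasible : Feasibleℕ (λ j → releaseTime m (k + a) (toℕ j)) (λ j → procTime m k (toℕ j)) f μ)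
    (fits : m * suc k ≤ n) (x≤window : x ≤ count (window? m k a f)) where

    open Feasibleℕ feasible

    private
      τ = k + a

      r : Fin n → ℕ
      r j = releaseTime m τ (toℕ j)

      released? started? startedAt? : ∀ v j → Dec _
      released?  v j = ¬? (big? m j) ×-dec (r j ≤? v)
      started?   v j = ¬? (big? m j) ×-dec (f j ≤? v)
      startedAt? v j = ¬? (big? m j) ×-dec (f j ≟ v)

      waiting? : ∀ v j → Dec (r j ≤ v × v < f j)
      waiting? v j = (r j ≤? v) ×-dec (v <? f j)

    -- The big jobs of the window still run at `τ + l`, and so does a unit job starting then; all of
    -- them share the `m` machines.
    startedAt+x≤m : ∀ l → l < k → count (startedAt? (τ + l)) + x ≤ m
    startedAt+x≤m l l<k = begin
      count (startedAt? v) + x                         ≤⟨ +-monoʳ-≤ _ x≤window ⟩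
      count (startedAt? v) + count (window? m k a f)   ≤⟨ count-⊎ _ _ _ small big (λ _ p q → proj₁ p (proj₁ q)) ⟩
      count (running? feasible v)                      ≤⟨ count-running≤machines feasible v ⟩
      m                                                ∎
      where
      v = τ + l
      small : ∀ j → ¬ toℕ j < m × f j ≡ v → f j ≤ v × v < f j + procTime m k (toℕ j)
      small j (j≮m , f≡v) rewrite procTime-small {m} {k} j≮m =
        ≤-reflexive f≡v , subst (_< f j + 1) f≡v (m<m+n (f j) (s≤s z≤n))
      big : ∀ j → toℕ j < m × a ≤ f j × f j < k + a → f j ≤ v × v < f j + procTime m k (toℕ j)
      big j (j<m , a≤f , f<τ) rewrite procTime-big {m} {k} j<m =
        ≤-trans (<⇒≤ f<τ) (m≤m+n τ l) , (begin-strict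
          k + a + l     <⟨ +-monoʳ-< (k + a) l<k ⟩
          k + a + k     ≡⟨ rearrange k a ⟩
          a + 2 * k     ≤⟨ +-monoˡ-≤ (2 * k) a≤f ⟩
          f j + 2 * k   ∎)
        where
        rearrange : ∀ k a → k + a + k ≡ a + 2 * k
        rearrange = solve-∀

    -- Nothing of the stream has started by `τ`, and each of the next `l` integer times admits at
    -- most `m - x` starts. The term `x * l` stays on the left to avoid truncated subtraction.
    started+x*l≤m*l : ∀ l → l < k → count (started? (τ + l)) + x * l ≤ m * l
    started+x*l≤m*l zero    _    = begin
      count (started? (τ + 0)) + x * 0 ≡⟨ cong (_+ x * 0) (count-none (started? (τ + 0)) none) ⟩
      x * 0                            ≡⟨ trans (*-zeroʳ x) (sym (*-zeroʳ m)) ⟩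
      m * 0                            ∎
      where
      none : ∀ j → ¬ (¬ toℕ j < m × f j ≤ τ + 0)
      none j (j≮m , f≤τ) = <-irrefl refl (begin-strict
        τ         <⟨ τ<releaseTime-small {m} {τ} j≮m ⟩
        r j       ≤⟨ released j ⟩
        f j       ≤⟨ f≤τ ⟩
        τ + 0     ≡⟨ +-identityʳ τ ⟩
        τ         ∎)
    started+x*l≤m*l (suc l) l<k = begin
      count (started? (τ + suc l)) + x * suc l
        ≤⟨ +-monoˡ-≤ (x * suc l) (count-∪ _ (started? (τ + l)) (startedAt? (τ + suc l)) split) ⟩
      W + A + x * suc l        ≡⟨ cong (W + A +_) (*-suc x l) ⟩
      W + A + (x + x * l)      ≡⟨ rearrange W A x (x * l) ⟩
      (W + x * l) + (A + x)    ≤⟨ +-mono-≤ (started+x*l≤m*l l (<⇒≤ l<k)) (startedAt+x≤m (suc l) l<k) ⟩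
      m * l + m                ≡⟨ trans (+-comm (m * l) m) (sym (*-suc m l)) ⟩
      m * suc l                ∎
      where
      W = count (started? (τ + l))
      A = count (startedAt? (τ + suc l))
      rearrange : ∀ w a x y → w + a + (x + y) ≡ (w + y) + (a + x)
      rearrange = solve-∀
      split : ∀ j → ¬ toℕ j < m × f j ≤ τ + suc l →
              (¬ toℕ j < m × f j ≤ τ + l) ⊎ (¬ toℕ j < m × f j ≡ τ + suc l)
      split j (j≮m , f≤) with m≤n⇒m<n∨m≡n f≤
      ... | inj₁ f< = inj₁ (j≮m , ≤-pred (subst (f j <_) (+-suc τ l) f<))
      ... | inj₂ f≡ = inj₂ (j≮m , f≡)

    -- The indices below `m * suc l` are the `m` big jobs and `m * l` stream jobs due by `τ + l`;
    -- `fits` guarantees that they all exist.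
    m*l≤released : ∀ l → l ≤ k → m * l ≤ count (released? (τ + l))
    m*l≤released l l≤k = +-cancelˡ-≤ m _ _ (begin
      m + m * l                                        ≡⟨ *-suc m l ⟨
      m * suc l                                        ≡⟨ count-toℕ< enough ⟨
      count (λ (j : Fin n) → toℕ j <? m * suc l)       ≤⟨ count-∪ _ (big? m) (released? (τ + l)) split ⟩
      count (big? {n} m) + count (released? (τ + l))   ≡⟨ cong (_+ count (released? (τ + l))) (count-toℕ< m≤n) ⟩
      m + count (released? (τ + l))                    ∎)
      where
      enough : m * suc l ≤ n
      enough = ≤-trans (*-monoʳ-≤ m (s≤s l≤k)) fits
      m≤n : m ≤ n
      m≤n = ≤-trans (m≤m*n m (suc k)) fits
      split : ∀ j → toℕ j < m * suc l → toℕ j < m ⊎ (¬ toℕ j < m × r j ≤ τ + l)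
      split j j< with toℕ j <? m
      ... | yes j<m = inj₁ j<m
      ... | no j≮m  = inj₂ (j≮m , +-monoʳ-≤ τ (≤-pred (m<n*o⇒m/o<n
                        (subst (toℕ j <_) (*-comm m (suc l)) j<))))

    x*l≤waiting : ∀ l → l < k → x * l ≤ count (waiting? (τ + l))
    x*l≤waiting l l<k = +-cancelˡ-≤ W _ _ (begin
      W + x * l                              ≤⟨ started+x*l≤m*l l l<k ⟩
      m * l                                  ≤⟨ m*l≤released l (<⇒≤ l<k) ⟩
      count (released? (τ + l))              ≤⟨ count-∪ _ (started? (τ + l)) (waiting? (τ + l)) split ⟩
      W + count (waiting? (τ + l))           ∎)
      where
      W = count (started? (τ + l))
      split : ∀ j → ¬ toℕ j < m × r j ≤ τ + l →
              (¬ toℕ j < m × f j ≤ τ + l) ⊎ (r j ≤ τ + l × τ + l < f j)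
      split j (j≮m , r≤) with f j ≤? τ + l
      ... | yes f≤ = inj₁ (j≮m , f≤)
      ... | no f≰  = inj₂ (r≤ , ≰⇒> f≰)

    private
      -- The share of the delay of `j` accrued by time `v`; truncated subtraction makes it 0 before
      -- the release.
      delayUntil : ℕ → Fin n → ℕ
      delayUntil v j = (f j ⊓ v) ∸ r j

    waiting-accumulates : ∀ v → count (waiting? v) + sum (delayUntil v) ≤ sum (delayUntil (suc v))
    waiting-accumulates v = count-step (waiting? v) (delayUntil v) (delayUntil (suc v))
      (λ j → ∸-monoˡ-≤ (r j) (⊓-monoʳ-≤ (f j) (n≤1+n v)))
      λ j (r≤v , v<f) → begin-strict
        (f j ⊓ v) ∸ r j       ≡⟨ cong (_∸ r j) (m≥n⇒m⊓n≡n (<⇒≤ v<f)) ⟩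
        v ∸ r j               <⟨ ∸-monoˡ-< ≤-refl r≤v ⟩
        suc v ∸ r j           ≡⟨ cong (_∸ r j) (m≥n⇒m⊓n≡n v<f) ⟨
        (f j ⊓ suc v) ∸ r j   ∎

    -- Summing the waiting bounds over the times before `l` gives `x * l * (l - 1) / 2`; the
    -- statement is this bound doubled and freed of subtraction.
    delayUntil-bound : ∀ l → l ≤ k → x * l * l ≤ 2 * sum (delayUntil (τ + l)) + x * l
    delayUntil-bound zero    _   = ≤-trans (≤-reflexive (*-zeroʳ (x * 0))) z≤n
    delayUntil-bound (suc l) l<k = begin
      x * suc l * suc l                    ≡⟨ expand x l ⟩
      x * l * l + (2 * (x * l) + x)        ≤⟨ +-monoˡ-≤ _ (delayUntil-bound l (<⇒≤ l<k)) ⟩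
      2 * D + x * l + (2 * (x * l) + x)    ≡⟨ collect x l D ⟩
      2 * (x * l + D) + x * suc l          ≤⟨ +-monoˡ-≤ (x * suc l) (*-monoʳ-≤ 2 step) ⟩
      2 * sum (delayUntil (τ + suc l)) + x * suc l ∎
      where
      D = sum (delayUntil (τ + l))
      expand : ∀ x l → x * suc l * suc l ≡ x * l * l + (2 * (x * l) + x)
      expand = solve-∀
      collect : ∀ x l d → 2 * d + x * l + (2 * (x * l) + x) ≡ 2 * (x * l + d) + x * suc l
      collect = solve-∀
      step : x * l + D ≤ sum (delayUntil (τ + suc l))
      step = begin
        x * l + D                       ≤⟨ +-monoˡ-≤ D (x*l≤waiting l l<k) ⟩
        count (waiting? (τ + l)) + D    ≤⟨ waiting-accumulates (τ + l) ⟩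
        sum (delayUntil (suc (τ + l)))  ≡⟨ cong (sum ∘ delayUntil) (+-suc τ l) ⟨
        sum (delayUntil (τ + suc l))    ∎

    total-delay : 2 ≤ k → x * k * k ≤ 4 * sum (λ j → f j ∸ r j)
    total-delay 2≤k = +-cancelʳ-≤ (x * k * k) _ _ (begin
      x * k * k + x * k * k                ≤⟨ +-mono-≤ bound bound ⟩
      -- By `2 ≤ k`, the extra copy of `x * k * k` absorbs the lower-order terms and is then
      -- cancelled.
      (2 * D + x * k) + (2 * D + x * k)    ≡⟨ collect D (x * k) ⟩
      4 * D + x * k * 2                    ≤⟨ +-monoʳ-≤ (4 * D) (*-monoʳ-≤ (x * k) 2≤k) ⟩
      4 * D + x * k * k                    ≤⟨ +-monoˡ-≤ (x * k * k) (*-monoʳ-≤ 4 (sum-mono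
                                                λ j → ∸-monoˡ-≤ (r j) (m⊓n≤m (f j) (τ + k)))) ⟩
      4 * sum (λ j → f j ∸ r j) + x * k * k ∎)
      where
      D = sum (delayUntil (τ + k))
      bound = delayUntil-bound k ≤-refl
      collect : ∀ d y → (2 * d + y) + (2 * d + y) ≡ 4 * d + y * 2
      collect = solve-∀

  -- Case of no crowded window: half of the big jobs wait long.

  module Idle {n m k τ I q : ℕ} .{{_ : NonZero m}} (f : Fin n → ℕ) (m≤n : m ≤ n)
    (rare : ∀ i → i < I → count (window? m k (i * k) f) ≤ q) (2Iq≤m : 2 * (I * q) ≤ m) where

    private
      early? : ∀ v j → Dec (toℕ j < m × f j < v)
      early? v j = big? m j ×-dec (f j <? v)

      late? : ∀ j → Dec (toℕ j < m × ¬ f j < I * k)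
      late? j = big? m j ×-dec ¬? (f j <? I * k)

    -- Consecutive windows of length `k` tile the time from 0 on, so their bounds `q` add up.
    early≤i*q : ∀ i → i ≤ I → count (early? (i * k)) ≤ i * q
    early≤i*q zero    _   = ≤-reflexive (count-none (early? 0) λ _ ())
    early≤i*q (suc i) i<I = begin
      count (early? (suc i * k))                            ≤⟨ count-∪ _ (window? m k (i * k) f) (early? (i * k)) split ⟩
      count (window? m k (i * k) f) + count (early? (i * k)) ≤⟨ +-mono-≤ (rare i i<I) (early≤i*q i (<⇒≤ i<I)) ⟩
      q + i * q                                             ∎
      where
      split : ∀ j → toℕ j < m × f j < suc i * k →
              (toℕ j < m × i * k ≤ f j × f j < k + i * k) ⊎ (toℕ j < m × f j < i * k)
      split j (j<m , f<) with f j <? i * k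
      ... | yes f<ik = inj₂ (j<m , f<ik)
      ... | no f≮ik  = inj₁ (j<m , ≮⇒≥ f≮ik , f<)

    -- Of the `m` big jobs at most `I * q`, hence at most half, start before `I * k`.
    m≤2*late : m ≤ 2 * count late?
    m≤2*late = +-cancelˡ-≤ m _ _ (begin
      m + m                                    ≡⟨ cong (m +_) (+-identityʳ m) ⟨
      2 * m                                    ≡⟨ cong (2 *_) (count-toℕ< m≤n) ⟨
      2 * count (big? {n} m)                   ≤⟨ *-monoʳ-≤ 2 (count-∪ _ (early? (I * k)) late? split) ⟩
      2 * (count (early? (I * k)) + L)         ≤⟨ *-monoʳ-≤ 2 (+-monoˡ-≤ L (early≤i*q I ≤-refl)) ⟩
      2 * (I * q + L)                          ≡⟨ *-distribˡ-+ 2 (I * q) L ⟩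
      2 * (I * q) + 2 * L                      ≤⟨ +-monoˡ-≤ (2 * L) 2Iq≤m ⟩
      m + 2 * L                                ∎)
      where
      L = count late?
      split : ∀ j → toℕ j < m → (toℕ j < m × f j < I * k) ⊎ (toℕ j < m × ¬ f j < I * k)
      split j j<m with f j <? I * k
      ... | yes f<Ik = inj₁ (j<m , f<Ik)
      ... | no f≮Ik  = inj₂ (j<m , f≮Ik)

    total-delay : m * (I * k) ≤ 2 * sum (λ j → f j ∸ releaseTime m τ (toℕ j))
    total-delay = begin
      m * (I * k)               ≤⟨ *-monoˡ-≤ (I * k) m≤2*late ⟩
      2 * count late? * (I * k) ≡⟨ *-assoc 2 (count late?) (I * k) ⟩
      2 * (count late? * (I * k)) ≤⟨ *-monoʳ-≤ 2 (count*≤sum late? _ (I * k) delayed) ⟩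
      2 * sum (λ j → f j ∸ releaseTime m τ (toℕ j)) ∎
      where
      delayed : ∀ j → toℕ j < m × ¬ f j < I * k → I * k ≤ f j ∸ releaseTime m τ (toℕ j)
      delayed j (j<m , f≮Ik) rewrite releaseTime-big {m} {τ} j<m = ≮⇒≥ f≮Ik

  -- The offline schedule and its cost.

  offlineStart : (m B τ i : ℕ) .{{_ : NonZero m}} → ℕ
  offlineStart m B τ i = ifBig m B (τ + i / m) i

  -- A batch, given by its quotient by `m`, uses each machine at most once, so distinct jobs on one
  -- machine have distinct quotients.
  roundRobin : {n : ℕ} (m : ℕ) .{{_ : NonZero m}} → Fin n → Fin m
  roundRobin m j = fromℕ< (m%n<n (toℕ j) m)

  -- The big jobs either end by `τ + 1`, when the first unit job can start, or begin after the
  -- stream: quotients are at most `n / m`, so it is over by `τ + suc (n / m)`.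
  module Offline {n m k τ B : ℕ} .{{_ : NonZero m}}
    (separated : (B + 2 * k ≤ suc τ) ⊎ (τ + suc (n / m) ≤ B)) where

    private
      r p s : Fin n → ℕ
      r j = releaseTime m τ (toℕ j)
      p j = procTime m k (toℕ j)
      s j = offlineStart m B τ (toℕ j)

    big-small : ∀ i j → toℕ i < m → ¬ toℕ j < m → (s i + p i ≤ s j) ⊎ (s j + p j ≤ s i)
    big-small i j i<m j≮m
      rewrite ifBig-big {m} {B} {τ + toℕ i / m} i<m | procTime-big {m} {k} i<m
            | ifBig-small {m} {B} {τ + toℕ j / m} j≮m | procTime-small {m} {k} j≮m
      = Sum.map before after separated
      where
      before : B + 2 * k ≤ suc τ → B + 2 * k ≤ τ + toℕ j / m
      before B+2k≤1+τ = begin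
        B + 2 * k         ≤⟨ B+2k≤1+τ ⟩
        suc τ             ≡⟨ +-comm 1 τ ⟩
        τ + 1             ≤⟨ +-monoʳ-≤ τ (m≥n⇒m/n>0 (≮⇒≥ j≮m)) ⟩
        τ + toℕ j / m     ∎
      after : τ + suc (n / m) ≤ B → τ + toℕ j / m + 1 ≤ B
      after τ+1+n/m≤B = begin
        τ + toℕ j / m + 1     ≡⟨ +-assoc τ _ 1 ⟩
        τ + (toℕ j / m + 1)   ≡⟨ cong (τ +_) (+-comm _ 1) ⟩
        τ + suc (toℕ j / m)   ≤⟨ +-monoʳ-≤ τ (s≤s (/-monoˡ-≤ m (<⇒≤ (Fin.toℕ<n j)))) ⟩
        τ + suc (n / m)       ≤⟨ τ+1+n/m≤B ⟩
        B                     ∎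

    small-small : ∀ i j → ¬ toℕ i < m → ¬ toℕ j < m → toℕ i / m < toℕ j / m → s i + p i ≤ s j
    small-small i j i≮m j≮m i/m<j/m
      rewrite ifBig-small {m} {B} {τ + toℕ i / m} i≮m | procTime-small {m} {k} i≮m
            | ifBig-small {m} {B} {τ + toℕ j / m} j≮m = begin
      τ + toℕ i / m + 1     ≡⟨ +-assoc τ _ 1 ⟩
      τ + (toℕ i / m + 1)   ≡⟨ cong (τ +_) (+-comm _ 1) ⟩
      τ + suc (toℕ i / m)   ≤⟨ +-monoʳ-≤ τ i/m<j/m ⟩
      τ + toℕ j / m         ∎

    offline-feasible : Feasibleℕ r p s (roundRobin m)
    offline-feasible = record { released = released ; disjoint = disjoint }
      where
      released : ∀ j → r j ≤ s j
      released j with toℕ j <? m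
      ... | yes _ = z≤n
      ... | no _  = ≤-refl
      disjoint : ∀ i j → i ≢ j → roundRobin m i ≡ roundRobin m j → (s i + p i ≤ s j) ⊎ (s j + p j ≤ s i)
      disjoint i j i≢j μi≡μj = cases (toℕ i <? m) (toℕ j <? m)
        where
        %≡ : toℕ i % m ≡ toℕ j % m
        %≡ = trans (sym (Fin.toℕ-fromℕ< _)) (trans (cong toℕ μi≡μj) (Fin.toℕ-fromℕ< _))
        quotients-differ : toℕ i / m ≢ toℕ j / m
        quotients-differ /≡ = i≢j (Fin.toℕ-injective (trans (m≡m%n+[m/n]*n (toℕ i) m)
          (trans (cong₂ (λ a b → a + b * m) %≡ /≡) (sym (m≡m%n+[m/n]*n (toℕ j) m)))))
        cases : Dec (toℕ i < m) → Dec (toℕ j < m) → (s i + p i ≤ s j) ⊎ (s j + p j ≤ s i)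
        cases (yes i<m) (no j≮m)  = big-small i j i<m j≮m
        cases (no i≮m)  (yes j<m) = Sum.swap (big-small j i j<m i≮m)
        -- Two big jobs would both have quotient 0.
        cases (yes i<m) (yes j<m) =
          contradiction (trans (m<n⇒m/n≡0 i<m) (sym (m<n⇒m/n≡0 j<m))) quotients-differ
        cases (no i≮m)  (no j≮m) with toℕ i / m <? toℕ j / m
        ... | yes lt = inj₁ (small-small i j i≮m j≮m lt)
        ... | no ≮   = inj₂ (small-small j i j≮m i≮m (≤∧≢⇒< (≮⇒≥ ≮) (quotients-differ ∘ sym)))

    -- Unit jobs are served on arrival and have flow 1; for simplicity this unit is charged to all
    -- `n` jobs.
    total-flow : m ≤ n → sum (λ j → s j + p j ∸ r j) ≤ m * (B + 2 * k) + n
    total-flow m≤n = begin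
      sum (λ j → s j + p j ∸ r j)                ≤⟨ sum≤count* (big? m) _ (B + 2 * k) 1 big small ⟩
      count (big? {n} m) * (B + 2 * k) + n * 1   ≡⟨ cong₂ (λ a b → a * (B + 2 * k) + b)
                                                      (count-toℕ< m≤n) (*-identityʳ n) ⟩
      m * (B + 2 * k) + n                        ∎
      where
      big : ∀ j → toℕ j < m → s j + p j ∸ r j ≤ B + 2 * k
      big j j<m with toℕ j <? m
      ... | yes _  = ≤-refl
      ... | no j≮m = contradiction j<m j≮m
      small : ∀ j → ¬ toℕ j < m → s j + p j ∸ r j ≤ 1
      small j j≮m with toℕ j <? m
      ... | yes j<m = contradiction j<m j≮m
      ... | no _    = ≤-reflexive (m+n∸m≡n (τ + toℕ j / m) 1)

  -- Choice of the parameters.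

  isqrt : ∀ k → ∃ λ y → y * y ≤ k × k < suc y * suc y
  isqrt zero    = 0 , z≤n , s≤s z≤n
  isqrt (suc k) with isqrt k
  ... | y , y²≤k , k<[1+y]² with suc k <? suc y * suc y
  ...   | yes 1+k<[1+y]² = y , ≤-trans y²≤k (n≤1+n k) , 1+k<[1+y]²
  ...   | no  1+k≮[1+y]² = suc y , ≮⇒≥ 1+k≮[1+y]² ,
            ≤-<-trans k<[1+y]² (*-mono-< (n<1+n (suc y)) (n<1+n (suc y)))

  -- ratio is, up to constants, max(√(n/m), n/m²); a window counts as crowded
  -- when more than quota big jobs start in it.
  record Parameters (n m : ℕ) : Set where
    field
      k ratio quota : ℕ
      2≤k      : 2 ≤ k
      1≤ratio  : 1 ≤ ratio
      fits     : m * suc k ≤ n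
      n/m≤1+k  : .{{_ : NonZero m}} → n / m ≤ suc k
      n≤2mk    : n ≤ 2 * (m * k)
      idle     : 2 * (ratio * quota) ≤ m
      crowded  : m * ratio ≤ 5 * (suc quota * k)
      n≤4m²ratio   : n ≤ 4 * (m * m * ratio)
      n<[4ratio]²m : n < (4 * ratio) * (4 * ratio) * m

  -- Here `k` is `n / m - 1`, at least 2 by `3 * m ≤ n`, and `y` is the integer square root of `k`.
  -- The sum `I = y + k / m` stands in for a maximum, and `q` is the largest number with
  -- `2 * (I * q) ≤ m`.
  parameters : ∀ n m .{{_ : NonZero m}} → 3 * m ≤ n → Parameters n m
  parameters n m 3m≤n with n / m in n/m≡
  ... | zero  = contradiction (m≥n⇒m/n>0 {n} {m} (≤-trans (m≤n*m m 3) 3m≤n))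
                  λ n/m>0 → <-irrefl refl (subst (0 <_) n/m≡ n/m>0)
  ... | suc k with isqrt k
  ...   | y , y²≤k , k<[1+y]² = record
    { k = k ; ratio = I ; quota = q
    ; 2≤k = 2≤k ; 1≤ratio = 1≤I
    ; fits = fits ; n/m≤1+k = ≤-reflexive n/m≡ ; n≤2mk = n≤2mk
    ; idle = idle ; crowded = crowded
    ; n≤4m²ratio = n≤4m²I ; n<[4ratio]²m = n<[4I]²m
    }
    where
    2≤k : 2 ≤ k
    2≤k = ≤-pred (subst (3 ≤_) n/m≡ (subst (_≤ n / m) (m*n/n≡m 3 m) (/-monoˡ-≤ m 3m≤n)))
    1≤m : 1 ≤ m
    1≤m = >-nonZero⁻¹ m
    1≤y : 1 ≤ y
    1≤y = n≢0⇒n>0 λ y≡0 →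
      <⇒≱ (subst (λ z → k < suc z * suc z) y≡0 k<[1+y]²) (<⇒≤ 2≤k)
    I = y + k / m
    1≤I : 1 ≤ I
    1≤I = ≤-trans 1≤y (m≤m+n y _)
    instance
      2I≢0 : NonZero (2 * I)
      2I≢0 = >-nonZero (≤-trans 1≤I (m≤m+n I _))
    q = m / (2 * I)
    n≡ : n ≡ n % m + suc k * m
    n≡ = trans (m≡m%n+[m/n]*n n m) (cong (λ d → n % m + d * m) n/m≡)
    n<[2+k]m : n < (2 + k) * m
    n<[2+k]m = begin-strict
      n                   ≡⟨ n≡ ⟩
      n % m + suc k * m   <⟨ +-monoˡ-< (suc k * m) (m%n<n n m) ⟩
      (2 + k) * m         ∎
    fits : m * suc k ≤ n
    fits = begin
      m * suc k           ≡⟨ *-comm m (suc k) ⟩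
      suc k * m           ≤⟨ m≤n+m _ (n % m) ⟩
      n % m + suc k * m   ≡⟨ n≡ ⟨
      n                   ∎
    n≤2mk : n ≤ 2 * (m * k)
    n≤2mk = begin
      n             ≤⟨ <⇒≤ n<[2+k]m ⟩
      (2 + k) * m   ≤⟨ *-monoˡ-≤ m (+-monoˡ-≤ k 2≤k) ⟩
      (k + k) * m   ≡⟨ rearrange k m ⟩
      2 * (m * k)   ∎
      where
      rearrange : ∀ k m → (k + k) * m ≡ 2 * (m * k)
      rearrange = solve-∀
    idle : 2 * (I * q) ≤ m
    idle = begin
      2 * (I * q)   ≡⟨ rearrange I q ⟩
      q * (2 * I)   ≤⟨ m/n*n≤m m (2 * I) ⟩
      m             ∎
      where
      rearrange : ∀ i q → 2 * (i * q) ≡ q * (2 * i)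
      rearrange = solve-∀
    m[k/m]≤k : m * (k / m) ≤ k
    m[k/m]≤k = ≤-trans (≤-reflexive (*-comm m (k / m))) (m/n*n≤m k m)
    k≤[1+q]k : k ≤ suc q * k
    k≤[1+q]k = m≤m+n k (q * k)
    m≤[1+q]2I : m ≤ suc q * (2 * I)
    m≤[1+q]2I = begin
      m                             ≡⟨ m≡m%n+[m/n]*n m (2 * I) ⟩
      m % (2 * I) + q * (2 * I)     ≤⟨ +-monoˡ-≤ (q * (2 * I)) (m%n≤n m (2 * I)) ⟩
      suc q * (2 * I)               ∎
    -- The larger summand of `I` decides. If it is `y`, then `I ≤ 2 * y`, and `m ≤ suc q * (2 * I)`
    -- with `y * y ≤ k` suffices; otherwise `m * y` is at most `m * (k / m) ≤ k`.
    my≤4[1+q]k : m * y ≤ 4 * (suc q * k)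
    my≤4[1+q]k with k / m ≤? y
    ... | yes k/m≤y = begin
      m * y                       ≤⟨ *-monoˡ-≤ y m≤[1+q]2I ⟩
      suc q * (2 * I) * y         ≤⟨ *-monoˡ-≤ y (*-monoʳ-≤ (suc q) (*-monoʳ-≤ 2 (+-monoʳ-≤ y k/m≤y))) ⟩
      suc q * (2 * (y + y)) * y   ≡⟨ rearrange (suc q) y ⟩
      4 * (suc q * (y * y))       ≤⟨ *-monoʳ-≤ 4 (*-monoʳ-≤ (suc q) y²≤k) ⟩
      4 * (suc q * k)             ∎
      where
      rearrange : ∀ x y → x * (2 * (y + y)) * y ≡ 4 * (x * (y * y))
      rearrange = solve-∀
    ... | no k/m≰y = begin
      m * y             ≤⟨ *-monoʳ-≤ m (<⇒≤ (≰⇒> k/m≰y)) ⟩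
      m * (k / m)       ≤⟨ ≤-trans m[k/m]≤k k≤[1+q]k ⟩
      suc q * k         ≤⟨ m≤n*m (suc q * k) 4 ⟩
      4 * (suc q * k)   ∎
    crowded : m * I ≤ 5 * (suc q * k)
    crowded = begin
      m * I                         ≡⟨ *-distribˡ-+ m y (k / m) ⟩
      m * y + m * (k / m)           ≤⟨ +-mono-≤ my≤4[1+q]k (≤-trans m[k/m]≤k k≤[1+q]k) ⟩
      4 * (suc q * k) + suc q * k   ≡⟨ +-comm (4 * (suc q * k)) (suc q * k) ⟩
      5 * (suc q * k)               ∎
    -- The summand `k / m` of `I` matters here: `k` is at most `m + k / m * m`, and the remaining
    -- terms are paid by `3 * I`.
    n≤4m²I : n ≤ 4 * (m * m * I)
    n≤4m²I = begin
      n                                       ≤⟨ <⇒≤ n<[2+k]m ⟩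
      (2 + k) * m                             ≡⟨ cong (λ d → (2 + d) * m) (m≡m%n+[m/n]*n k m) ⟩
      (2 + (k % m + k / m * m)) * m           ≤⟨ *-monoˡ-≤ m (+-mono-≤ (*-monoʳ-≤ 2 1≤m)
                                                   (+-monoˡ-≤ (k / m * m) (m%n≤n k m))) ⟩
      (2 * m + (m + k / m * m)) * m           ≡⟨ rearrange₁ m (k / m) ⟩
      m * m * (3 * 1 + k / m)                 ≤⟨ *-monoʳ-≤ (m * m) (+-mono-≤ (*-monoʳ-≤ 3 1≤I) (m≤n+m (k / m) y)) ⟩
      m * m * (3 * I + I)                     ≡⟨ rearrange₂ (m * m) I ⟩
      4 * (m * m * I)                         ∎
      where
      rearrange₁ : ∀ m d → (2 * m + (m + d * m)) * m ≡ m * m * (3 * 1 + d)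
      rearrange₁ = solve-∀
      rearrange₂ : ∀ a i → a * (3 * i + i) ≡ 4 * (a * i)
      rearrange₂ = solve-∀
    -- The summand `y` matters here: `k` is below the square of `suc y`, and `suc y ≤ 2 * I`.
    n<[4I]²m : n < (4 * I) * (4 * I) * m
    n<[4I]²m = <-≤-trans n<[2+k]m (*-monoˡ-≤ m (begin
      2 + k                       ≤⟨ s≤s k<[1+y]² ⟩
      1 + suc y * suc y           ≤⟨ +-mono-≤ (*-mono-≤ 1≤I 1≤I) (*-mono-≤ 1+y≤2I 1+y≤2I) ⟩
      -- Five copies of `I * I` are rounded up to sixteen, so that the factor 4 agrees with the one
      -- in `n≤4m²I`.
      I * I + 2 * I * (2 * I)     ≤⟨ m≤m+n _ (11 * (I * I)) ⟩
      I * I + 2 * I * (2 * I) + 11 * (I * I) ≡⟨ rearrange I ⟩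
      4 * I * (4 * I)             ∎))
      where
      1+y≤2I : suc y ≤ 2 * I
      1+y≤2I = +-mono-≤ 1≤I (≤-trans (m≤m+n y (k / m)) (≤-reflexive (sym (+-identityʳ I))))
      rearrange : ∀ i → i * i + 2 * i * (2 * i) + 11 * (i * i) ≡ 4 * i * (4 * i)
      rearrange = solve-∀

  -- The adversary's choice of `τ`.

  module Response {n m : ℕ} .{{_ : NonZero m}} (params : Parameters n m)
    (f : ℕ → Fin n → ℕ) (μ : ℕ → Fin n → Fin m)
    (feasible : ∀ τ → Feasibleℕ (λ j → releaseTime m τ (toℕ j))
                                (λ j → procTime m (Parameters.k params) (toℕ j)) (f τ) (μ τ))
    (online : ∀ τ T j → τ ≤ T → f T j < τ → f τ j ≡ f T j) where

    open Parameters params renaming (ratio to I; quota to q)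

    delay : ℕ → ℕ
    delay τ = sum (λ j → f τ j ∸ releaseTime m τ (toℕ j))

    Lost : ℕ → ℕ → Set
    Lost τ B = ((B + 2 * k ≤ suc τ) ⊎ (τ + suc (n / m) ≤ B)) ×
               I * (m * (B + 2 * k) + n) ≤ 160 * delay τ

    m≤n : m ≤ n
    m≤n = ≤-trans (m≤m*n m (suc k)) fits

    -- With `B ≤ 4 * k` and `n ≤ 2 * (m * k)` the offline cost is at most `8 * (m * k)`, and 160 is
    -- 8 times 20.
    scale : ∀ τ B → B ≤ 4 * k → m * (I * k) ≤ 20 * delay τ → I * (m * (B + 2 * k) + n) ≤ 160 * delay τ
    scale τ B B≤4k bound = begin
      I * (m * (B + 2 * k) + n)                   ≤⟨ *-monoʳ-≤ I (+-mono-≤ (*-monoʳ-≤ m (+-monoˡ-≤ (2 * k) B≤4k)) n≤2mk) ⟩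
      I * (m * (4 * k + 2 * k) + 2 * (m * k))     ≡⟨ rearrange I m k ⟩
      8 * (m * (I * k))                           ≤⟨ *-monoʳ-≤ 8 bound ⟩
      8 * (20 * delay τ)                          ≡⟨ *-assoc 8 20 (delay τ) ⟨
      160 * delay τ                               ∎
      where
      rearrange : ∀ i m k → i * (m * (4 * k + 2 * k) + 2 * (m * k)) ≡ 8 * (m * (i * k))
      rearrange = solve-∀

    -- The probing instance holds its stream back past all `I` windows; the extra `k` leaves room
    -- for a big job before the stream even when `I` is 1.
    T = suc I * k

    -- The algorithm is observed on the instance for `T`. Without a crowded window that instance
    -- already defeats it; otherwise `τ` is moved back to the end of a crowded window, a change the
    -- algorithm cannot foresee.
    lost : ∃ λ τ → ∃ λ B → Lost τ B
    lost with anyUpTo? (λ i → q <? count (window? m k (i * k) (f T))) I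
    ... | no ¬crowded = T , 0 , inj₁ 2k≤1+T , scale T 0 z≤n (begin
      m * (I * k)     ≤⟨ Idle.total-delay (f T) m≤n (λ i i<I → ≮⇒≥ λ q< → ¬crowded (i , i<I , q<)) idle ⟩
      -- The factor 2 is weakened to 20, which the crowded case reaches as 5 times 4.
      2 * delay T     ≤⟨ *-monoˡ-≤ (delay T) (m≤m+n 2 18) ⟩
      20 * delay T    ∎)
      where
      2k≤1+T : 2 * k ≤ suc T
      2k≤1+T = ≤-trans (*-monoˡ-≤ k (s≤s 1≤ratio)) (n≤1+n T)
    ... | yes (i , i<I , q<) = τ , proj₁ offline , proj₁ (proj₂ offline) ,
      scale τ (proj₁ offline) (proj₂ (proj₂ offline)) (begin
      m * (I * k)                 ≡⟨ *-assoc m I k ⟨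
      m * I * k                   ≤⟨ *-monoˡ-≤ k crowded ⟩
      5 * (suc q * k) * k         ≡⟨ *-assoc 5 (suc q * k) k ⟩
      5 * (suc q * k * k)         ≤⟨ *-monoʳ-≤ 5 (Blocked.total-delay (feasible τ) fits 1+q≤window 2≤k) ⟩
      5 * (4 * delay τ)           ≡⟨ *-assoc 5 4 (delay τ) ⟨
      20 * delay τ                ∎)
      where
      τ = suc i * k
      τ≤T : τ ≤ T
      τ≤T = *-monoˡ-≤ k (≤-trans i<I (n≤1+n I))
      -- The window ends at `τ`, and by `online` a job started before `τ` in the instance for `T`
      -- starts at the same time in the one for `τ`.
      1+q≤window : suc q ≤ count (window? m k (i * k) (f τ))
      1+q≤window = ≤-trans q< (count-mono (window? m k (i * k) (f T)) (window? m k (i * k) (f τ)) λ j (j<m , a≤f , f<τ) →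
        let f≡ = sym (online τ T j τ≤T f<τ)
        in j<m , subst (i * k ≤_) f≡ a≤f , subst (_< τ) f≡ f<τ)
      -- The big jobs go first if there is room before the stream, and after it otherwise.
      offline : ∃ λ B → ((B + 2 * k ≤ suc τ) ⊎ (τ + suc (n / m) ≤ B)) × B ≤ 4 * k
      offline with 2 * k ≤? suc τ
      ... | yes 2k≤1+τ = 0 , inj₁ 2k≤1+τ , z≤n
      ... | no  2k≰1+τ = τ + suc (n / m) , inj₂ ≤-refl , (begin
        τ + suc (n / m)     ≤⟨ +-monoʳ-≤ τ (s≤s n/m≤1+k) ⟩
        τ + (2 + k)         ≡⟨ rearrange τ k ⟩
        2 + τ + k           ≤⟨ +-mono-≤ (≰⇒> 2k≰1+τ) (m≤m+n k (k + 0)) ⟩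
        2 * k + 2 * k       ≡⟨ *-distribʳ-+ k 2 2 ⟨
        4 * k               ∎)
        where
        rearrange : ∀ t k → t + (2 + k) ≡ 2 + t + k
        rearrange = solve-∀

-- Transfer between integral and rational schedules.

module Rationals where
  import Data.Nat as ℕ
  import Data.Nat.Properties as ℕ
  import Data.Nat.DivMod as ℕ
  open import Data.Integer as ℤ using (+_; -[1+_]; +≤+; +<+)
  import Data.Integer.Properties as ℤ
  open import Data.Nat.Coprimality as Coprimality using (1-coprimeTo)
  open import Data.Rational using (ℚ; mkℚ; 0ℚ; 1ℚ; _+_; _*_; _-_; -_; _≤_; _<_; *≤*; *<*; nonNegative; _/_)
  open import Data.Rational.Properties
  open import Data.Rational.Solver using (module +-*-Solver)
  open ≤-Reasoning hiding (start)

  -- The division in `ℕ→ℚ` does not reduce for a variable `a`; the explicit normal form lets sums,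
  -- products and comparisons compute.
  ℕ→ℚ≡mkℚ : ∀ a → ℕ→ℚ a ≡ mkℚ (+ a) 0 (Coprimality.sym (1-coprimeTo a))
  ℕ→ℚ≡mkℚ a = ↥p/↧p≡p (mkℚ (+ a) 0 (Coprimality.sym (1-coprimeTo a)))

  ℕ→ℚ-+ : ∀ a b → ℕ→ℚ (a ℕ.+ b) ≡ ℕ→ℚ a + ℕ→ℚ b
  ℕ→ℚ-+ a b rewrite ℕ→ℚ≡mkℚ a | ℕ→ℚ≡mkℚ b =
    cong (_/ 1) (sym (cong₂ ℤ._+_ (ℤ.*-identityʳ (+ a)) (ℤ.*-identityʳ (+ b))))

  ℕ→ℚ-* : ∀ a b → ℕ→ℚ (a ℕ.* b) ≡ ℕ→ℚ a * ℕ→ℚ b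
  ℕ→ℚ-* a b rewrite ℕ→ℚ≡mkℚ a | ℕ→ℚ≡mkℚ b = cong (_/ 1) (ℤ.pos-* a b)

  ℕ→ℚ-mono-≤ : ∀ {a b} → a ℕ.≤ b → ℕ→ℚ a ≤ ℕ→ℚ b
  ℕ→ℚ-mono-≤ {a} {b} a≤b rewrite ℕ→ℚ≡mkℚ a | ℕ→ℚ≡mkℚ b =
    *≤* (ℤ.*-monoʳ-≤-nonNeg (+ 1) (+≤+ a≤b))

  ℕ→ℚ-mono-< : ∀ {a b} → a ℕ.< b → ℕ→ℚ a < ℕ→ℚ b
  ℕ→ℚ-mono-< {a} {b} a<b rewrite ℕ→ℚ≡mkℚ a | ℕ→ℚ≡mkℚ b =
    *<* (ℤ.*-monoʳ-<-pos (+ 1) (+<+ a<b))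

  ℕ→ℚ-cancel-≤ : ∀ {a b} → ℕ→ℚ a ≤ ℕ→ℚ b → a ℕ.≤ b
  ℕ→ℚ-cancel-≤ {a} {b} a≤b = ℕ.≮⇒≥ λ b<a → <-irrefl refl (<-≤-trans (ℕ→ℚ-mono-< {b} {a} b<a) a≤b)

  ℕ→ℚ-cancel-< : ∀ {a b} → ℕ→ℚ a < ℕ→ℚ b → a ℕ.< b
  ℕ→ℚ-cancel-< {a} {b} a<b = ℕ.≰⇒> λ b≤a → <-irrefl refl (<-≤-trans a<b (ℕ→ℚ-mono-≤ {b} {a} b≤a))

  0≤ℕ→ℚ : ∀ a → 0ℚ ≤ ℕ→ℚ a
  0≤ℕ→ℚ a = ℕ→ℚ-mono-≤ {0} {a} ℕ.z≤n

  -- 0 on negative arguments.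
  ⌊_⌋ : ℚ → ℕ
  ⌊ mkℚ (+ a) d _ ⌋    = a ℕ./ suc d
  ⌊ mkℚ -[1+ _ ] _ _ ⌋ = 0

  ⌊⌋≤ : ∀ {s} → 0ℚ ≤ s → ℕ→ℚ ⌊ s ⌋ ≤ s
  ⌊⌋≤ {mkℚ (+ a) d _} _ rewrite ℕ→ℚ≡mkℚ (a ℕ./ suc d) = *≤* (≤-lift (ℕ.m/n*n≤m a (suc d)))
    where
    ≤-lift : a ℕ./ suc d ℕ.* suc d ℕ.≤ a → + (a ℕ./ suc d) ℤ.* + suc d ℤ.≤ + a ℤ.* + 1
    ≤-lift p rewrite sym (ℤ.pos-* (a ℕ./ suc d) (suc d)) | ℤ.*-identityʳ (+ a) = +≤+ p
  ⌊⌋≤ {mkℚ -[1+ _ ] _ _} (*≤* ())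

  <1+⌊⌋ : ∀ {s} → 0ℚ ≤ s → s < ℕ→ℚ (suc ⌊ s ⌋)
  <1+⌊⌋ {mkℚ (+ a) d _} _ rewrite ℕ→ℚ≡mkℚ (suc (a ℕ./ suc d)) = *<* (<-lift (ℕ.≤-trans
      (ℕ.≤-reflexive (cong suc (ℕ.m≡m%n+[m/n]*n a (suc d))))
      (ℕ.+-monoˡ-≤ (a ℕ./ suc d ℕ.* suc d) (ℕ.m%n<n a (suc d)))))
    where
    <-lift : a ℕ.< suc (a ℕ./ suc d) ℕ.* suc d → + a ℤ.* + 1 ℤ.< + suc (a ℕ./ suc d) ℤ.* + suc d
    <-lift p rewrite sym (ℤ.pos-* (suc (a ℕ./ suc d)) (suc d)) | ℤ.*-identityʳ (+ a) = +<+ p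
  <1+⌊⌋ {mkℚ -[1+ _ ] _ _} (*≤* ())

  ≤⌊⌋ : ∀ {a s} → 0ℚ ≤ s → ℕ→ℚ a ≤ s → a ℕ.≤ ⌊ s ⌋
  ≤⌊⌋ {a} {s} 0≤s a≤s = ℕ.≤-pred (ℕ→ℚ-cancel-< {a} {suc ⌊ s ⌋} (≤-<-trans a≤s (<1+⌊⌋ 0≤s)))

  x≤y-z : ∀ {x y z} → x + z ≤ y → x ≤ y - z
  x≤y-z {x} {y} {z} x+z≤y = begin
    x             ≡⟨ solve 2 (λ x z → x := (x :+ z) :- z) refl x z ⟩
    (x + z) - z   ≤⟨ +-monoˡ-≤ (- z) x+z≤y ⟩
    y - z         ∎
    where open +-*-Solver

  y-z≤x : ∀ {x y z} → y ≤ x + z → y - z ≤ x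
  y-z≤x {x} {y} {z} y≤x+z = begin
    y - z         ≤⟨ +-monoˡ-≤ (- z) y≤x+z ⟩
    (x + z) - z   ≡⟨ solve 2 (λ x z → (x :+ z) :- z := x) refl x z ⟩
    x             ∎
    where open +-*-Solver

  sumFin-mono : ∀ {n} {f g : Fin n → ℚ} → (∀ j → f j ≤ g j) → sumFin n f ≤ sumFin n g
  sumFin-mono {zero}  f≤g = ≤-refl
  sumFin-mono {suc n} f≤g = +-mono-≤ (f≤g Fin.zero) (sumFin-mono (f≤g ∘ Fin.suc))

  open Counting using (sum)

  sumFin-ℕ→ℚ : ∀ {n} (f : Fin n → ℕ) → sumFin n (ℕ→ℚ ∘ f) ≡ ℕ→ℚ (sum f)
  sumFin-ℕ→ℚ {zero}  f = refl
  sumFin-ℕ→ℚ {suc n} f = trans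
    (cong (λ x → ℕ→ℚ (f Fin.zero) + x) (sumFin-ℕ→ℚ (f ∘ Fin.suc)))
    (sym (ℕ→ℚ-+ (f Fin.zero) (sum (f ∘ Fin.suc))))

  module _ {n m : ℕ} (J : Instance n) (S : Schedule n m) (valid : ValidInstance J) (S-feasible : Feasible J S) where

    0≤start : ∀ j → 0ℚ ≤ start S j
    0≤start j = ≤-trans (proj₁ (valid j)) (proj₁ S-feasible j)

    start≤completion : ∀ j → start S j ≤ completion J S j
    start≤completion j = begin
      start S j              ≡⟨ +-identityʳ (start S j) ⟨
      start S j + 0ℚ         ≤⟨ +-monoʳ-≤ (start S j) (<⇒≤ (proj₂ (valid j))) ⟩
      completion J S j       ∎

    -- Rounding the starts down and dropping the processing times both only lower the flow.
    totalFlow-lower : (r : Fin n → ℕ) → (∀ j → release (J j) ≡ ℕ→ℚ (r j)) →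
                      (∀ j → r j ℕ.≤ ⌊ start S j ⌋) →
                      ℕ→ℚ (sum (λ j → ⌊ start S j ⌋ ℕ.∸ r j)) ≤ totalFlow J S
    totalFlow-lower r r≡ r≤f = ≤-trans (≤-reflexive (sym (sumFin-ℕ→ℚ λ j → ⌊ start S j ⌋ ℕ.∸ r j))) (sumFin-mono λ j → x≤y-z (begin
      ℕ→ℚ (⌊ start S j ⌋ ℕ.∸ r j) + release (J j)   ≡⟨ cong (λ x → ℕ→ℚ (⌊ start S j ⌋ ℕ.∸ r j) + x) (r≡ j) ⟩
      ℕ→ℚ (⌊ start S j ⌋ ℕ.∸ r j) + ℕ→ℚ (r j)       ≡⟨ ℕ→ℚ-+ (⌊ start S j ⌋ ℕ.∸ r j) (r j) ⟨
      ℕ→ℚ (⌊ start S j ⌋ ℕ.∸ r j ℕ.+ r j)           ≡⟨ cong ℕ→ℚ (ℕ.m∸n+n≡m (r≤f j)) ⟩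
      ℕ→ℚ ⌊ start S j ⌋                             ≤⟨ ⌊⌋≤ (0≤start j) ⟩
      start S j                                     ≤⟨ start≤completion j ⟩
      completion J S j                              ∎))

    0≤totalFlow : 0ℚ ≤ totalFlow J S
    0≤totalFlow = ≤-trans (≤-reflexive (zeros n)) (sumFin-mono λ j → x≤y-z (begin
      0ℚ + release (J j)   ≡⟨ +-identityˡ (release (J j)) ⟩
      release (J j)        ≤⟨ proj₁ S-feasible j ⟩
      start S j            ≤⟨ start≤completion j ⟩
      completion J S j     ∎))
      where
      zeros : ∀ n → 0ℚ ≡ sumFin n (λ _ → 0ℚ)
      zeros zero    = refl
      zeros (suc n) = trans (zeros n) (sym (+-identityˡ (sumFin n (λ _ → 0ℚ))))

  open Adversary using (Feasibleℕ)

  integral : {n : ℕ} (r p : Fin n → ℕ) → Instance n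
  integral r p j = job (ℕ→ℚ (r j)) (ℕ→ℚ (p j))

  module _ {n m : ℕ} (r p : Fin n → ℕ) where

    integral-valid : (∀ j → 0 ℕ.< p j) → ValidInstance (integral r p)
    integral-valid 0<p j = 0≤ℕ→ℚ (r j) , ℕ→ℚ-mono-< (0<p j)

    -- With integral lengths, `⌊ start S i ⌋ + p i` is a natural number; if it is at most
    -- `start S j`, it is at most the floor as well.
    floor-feasible : (S : Schedule n m) → Feasible (integral r p) S →
                     Feasibleℕ r p (λ j → ⌊ start S j ⌋) (machine S)
    floor-feasible S (released , disjoint) = record
      { released = λ j → ≤⌊⌋ (0≤s j) (released j)
      ; disjoint = λ i j i≢j μ≡ → Sum.map (later i j) (later j i) (disjoint i j i≢j μ≡)
      }
      where
      0≤s : ∀ j → 0ℚ ≤ start S j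
      0≤s j = ≤-trans (0≤ℕ→ℚ (r j)) (released j)
      later : ∀ i j → completion (integral r p) S i ≤ start S j → ⌊ start S i ⌋ ℕ.+ p i ℕ.≤ ⌊ start S j ⌋
      later i j ci≤sj = ≤⌊⌋ (0≤s j) (begin
        ℕ→ℚ (⌊ start S i ⌋ ℕ.+ p i)         ≡⟨ ℕ→ℚ-+ ⌊ start S i ⌋ (p i) ⟩
        ℕ→ℚ ⌊ start S i ⌋ + ℕ→ℚ (p i)       ≤⟨ +-monoˡ-≤ (ℕ→ℚ (p i)) (⌊⌋≤ (0≤s i)) ⟩
        completion (integral r p) S i       ≤⟨ ci≤sj ⟩
        start S j                           ∎)

    module _ (s : Fin n → ℕ) (μ : Fin n → Fin m) (s-feasible : Feasibleℕ r p s μ) where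
      open Feasibleℕ s-feasible

      embed-feasible : Feasible (integral r p) (sched μ (ℕ→ℚ ∘ s))
      embed-feasible = (λ j → ℕ→ℚ-mono-≤ (released j)) ,
        λ i j i≢j μ≡ → Sum.map (later i j) (later j i) (disjoint i j i≢j μ≡)
        where
        later : ∀ i j → s i ℕ.+ p i ℕ.≤ s j → ℕ→ℚ (s i) + ℕ→ℚ (p i) ≤ ℕ→ℚ (s j)
        later i j c≤s = ≤-trans (≤-reflexive (sym (ℕ→ℚ-+ (s i) (p i)))) (ℕ→ℚ-mono-≤ c≤s)

      totalFlow-embed : totalFlow (integral r p) (sched μ (ℕ→ℚ ∘ s)) ≤ ℕ→ℚ (sum (λ j → s j ℕ.+ p j ℕ.∸ r j))
      totalFlow-embed = ≤-trans (sumFin-mono λ j → y-z≤x (begin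
        ℕ→ℚ (s j) + ℕ→ℚ (p j)                         ≡⟨ ℕ→ℚ-+ (s j) (p j) ⟨
        ℕ→ℚ (s j ℕ.+ p j)                             ≤⟨ ℕ→ℚ-mono-≤ (ℕ.≤-trans (ℕ.m≤n+m∸n (s j ℕ.+ p j) (r j))
                                                           (ℕ.≤-reflexive (ℕ.+-comm (r j) _))) ⟩
        ℕ→ℚ (s j ℕ.+ p j ℕ.∸ r j ℕ.+ r j)             ≡⟨ ℕ→ℚ-+ (s j ℕ.+ p j ℕ.∸ r j) (r j) ⟩
        ℕ→ℚ (s j ℕ.+ p j ℕ.∸ r j) + ℕ→ℚ (r j)         ∎)) (≤-reflexive (sumFin-ℕ→ℚ λ j → s j ℕ.+ p j ℕ.∸ r j))

  *-mono-≤ : ∀ {a b x y} → 0ℚ ≤ x → 0ℚ ≤ b → a ≤ b → x ≤ y → a * x ≤ b * y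
  *-mono-≤ {a} {b} {x} {y} 0≤x 0≤b a≤b x≤y = ≤-trans
    (*-monoʳ-≤-nonNeg x {{nonNegative 0≤x}} a≤b) (*-monoˡ-≤-nonNeg b {{nonNegative 0≤b}} x≤y)

  0≤* : ∀ {x y} → 0ℚ ≤ x → 0ℚ ≤ y → 0ℚ ≤ x * y
  0≤* {x} {y} 0≤x 0≤y = ≤-trans (≤-reflexive (sym (*-zeroˡ 0ℚ))) (*-mono-≤ ≤-refl 0≤x 0≤x 0≤y)

  ℕ→ℚ-*-monoˡ-≤ : ∀ {a b x} → a ℕ.≤ b → 0ℚ ≤ x → ℕ→ℚ a * x ≤ ℕ→ℚ b * x
  ℕ→ℚ-*-monoˡ-≤ {x = x} a≤b 0≤x = *-monoʳ-≤-nonNeg x {{nonNegative 0≤x}} (ℕ→ℚ-mono-≤ a≤b)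

  ℕ→ℚ-*-sandwich : ∀ {a b u v x y} → x ≤ ℕ→ℚ u → ℕ→ℚ v ≤ y → a ℕ.* u ℕ.≤ b ℕ.* v →
                   ℕ→ℚ a * x ≤ ℕ→ℚ b * y
  ℕ→ℚ-*-sandwich {a} {b} {u} {v} {x} {y} x≤u v≤y au≤bv = begin
    ℕ→ℚ a * x         ≤⟨ *-monoˡ-≤-nonNeg (ℕ→ℚ a) {{nonNegative (0≤ℕ→ℚ a)}} x≤u ⟩
    ℕ→ℚ a * ℕ→ℚ u     ≡⟨ ℕ→ℚ-* a u ⟨
    ℕ→ℚ (a ℕ.* u)     ≤⟨ ℕ→ℚ-mono-≤ au≤bv ⟩
    ℕ→ℚ (b ℕ.* v)     ≡⟨ ℕ→ℚ-* b v ⟩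
    ℕ→ℚ b * ℕ→ℚ v     ≤⟨ *-monoˡ-≤-nonNeg (ℕ→ℚ b) {{nonNegative (0≤ℕ→ℚ b)}} v≤y ⟩
    ℕ→ℚ b * y         ∎

  -- If `K < s`, then `K * K * M ≤ s * s * M ≤ N`, against the strict bound on `N`. This replaces a
  -- real square root.
  square-cancel-≤ : ∀ {s K M N} → 0ℚ ≤ K → 0ℚ ≤ M → N < K * K * M → s * s * M ≤ N → s ≤ K
  square-cancel-≤ {s} {K} {M} {N} 0≤K 0≤M N<K²M s²M≤N = ≮⇒≥ λ K<s →
    let K≤s = <⇒≤ K<s
        0≤s = ≤-trans 0≤K K≤s
    in <-irrefl refl (<-≤-trans N<K²M (≤-trans
         (*-monoʳ-≤-nonNeg M {{nonNegative 0≤M}} (*-mono-≤ 0≤K 0≤s K≤s K≤s)) s²M≤N))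

  -- Both `N` and `M * M * s` are at most `k * (M * M * I)`, hence the factor `k + k`; `c` cancels
  -- it together with the loss `d`.
  scaled-ratio : ∀ {c k d M I N s opt alg} → 0ℚ ≤ c → 0ℚ ≤ k → 0ℚ ≤ M → 0ℚ ≤ I → 0ℚ ≤ opt →
                 c * (k + k) * d ≡ 1ℚ → N ≤ k * (M * M * I) → s ≤ k * I → I * opt ≤ d * alg →
                 c * (N + M * M * s) * opt ≤ M * M * alg
  scaled-ratio {c} {k} {d} {M} {I} {N} {s} {opt} {alg} 0≤c 0≤k 0≤M 0≤I 0≤opt c·2k·d≡1 N≤kM²I s≤kI bound = begin
    c * (N + M * M * s) * opt
      ≤⟨ *-monoʳ-≤-nonNeg opt {{nonNegative 0≤opt}} (*-monoˡ-≤-nonNeg c {{nonNegative 0≤c}} N+M²s≤2kM²I) ⟩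
    c * ((k + k) * (M * M * I)) * opt
      ≡⟨ solve 5 (λ c e m i o → c :* (e :* (m :* i)) :* o := c :* e :* m :* (i :* o)) refl c (k + k) (M * M) I opt ⟩
    c * (k + k) * (M * M) * (I * opt)
      ≤⟨ *-monoˡ-≤-nonNeg (c * (k + k) * (M * M)) {{nonNegative (0≤* (0≤* 0≤c (+-mono-≤ 0≤k 0≤k)) 0≤M²)}} bound ⟩
    c * (k + k) * (M * M) * (d * alg)
      ≡⟨ solve 4 (λ e d m a → e :* m :* (d :* a) := e :* d :* (m :* a)) refl (c * (k + k)) d (M * M) alg ⟩
    c * (k + k) * d * (M * M * alg)   ≡⟨ cong (_* (M * M * alg)) c·2k·d≡1 ⟩
    1ℚ * (M * M * alg)                ≡⟨ *-identityˡ (M * M * alg) ⟩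
    M * M * alg                       ∎
    where
    open +-*-Solver
    0≤M² : 0ℚ ≤ M * M
    0≤M² = 0≤* 0≤M 0≤M
    N+M²s≤2kM²I : N + M * M * s ≤ (k + k) * (M * M * I)
    N+M²s≤2kM²I = begin
      N + M * M * s
        ≤⟨ +-mono-≤ N≤kM²I (*-monoˡ-≤-nonNeg (M * M) {{nonNegative 0≤M²}} s≤kI) ⟩
      k * (M * M * I) + M * M * (k * I)
        ≡⟨ solve 3 (λ k m i → k :* (m :* i) :+ m :* (k :* i) := (k :+ k) :* (m :* i)) refl k (M * M) I ⟩
      (k + k) * (M * M * I)   ∎

  -- 1 / (2 · 4 · 160), with 4 from Parameters and 160 from Response.Lost.
  c : ℚ
  c = + 1 / 1280

  -- The two hypotheses on `n` serve the two terms of the ratio; the second bounds `s` by `4 * I`.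
  competitive : ∀ {n m I} → n ℕ.≤ 4 ℕ.* (m ℕ.* m ℕ.* I) → n ℕ.< (4 ℕ.* I) ℕ.* (4 ℕ.* I) ℕ.* m →
                ∀ {opt alg} → 0ℚ ≤ opt → ℕ→ℚ I * opt ≤ ℕ→ℚ 160 * alg →
                ∀ {s} → s * s * ℕ→ℚ m ≤ ℕ→ℚ n →
                c * (ℕ→ℚ n + ℕ→ℚ m * ℕ→ℚ m * s) * opt ≤ ℕ→ℚ m * ℕ→ℚ m * alg
  competitive {n} {m} {I} n≤ n< {opt} {alg} 0≤opt bound {s} s²m≤n =
    scaled-ratio {c} {ℕ→ℚ 4} {ℕ→ℚ 160} {ℕ→ℚ m} {ℕ→ℚ I} {ℕ→ℚ n} {s} {opt} {alg}
      (nonNegative⁻¹ c) (0≤ℕ→ℚ 4) (0≤ℕ→ℚ m) (0≤ℕ→ℚ I) 0≤opt refl n≤ℚ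
      (≤-trans s≤4I (≤-reflexive (ℕ→ℚ-* 4 I))) bound
    where
    n≤ℚ : ℕ→ℚ n ≤ ℕ→ℚ 4 * (ℕ→ℚ m * ℕ→ℚ m * ℕ→ℚ I)
    n≤ℚ = ≤-trans (ℕ→ℚ-mono-≤ n≤) (≤-reflexive (trans (ℕ→ℚ-* 4 (m ℕ.* m ℕ.* I))
      (cong (λ x → ℕ→ℚ 4 * x) (trans (ℕ→ℚ-* (m ℕ.* m) I) (cong (λ x → x * ℕ→ℚ I) (ℕ→ℚ-* m m))))))
    s≤4I : s ≤ ℕ→ℚ (4 ℕ.* I)
    s≤4I = square-cancel-≤ {s} {ℕ→ℚ (4 ℕ.* I)} {ℕ→ℚ m} {ℕ→ℚ n} (0≤ℕ→ℚ (4 ℕ.* I)) (0≤ℕ→ℚ m)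
      (<-≤-trans (ℕ→ℚ-mono-< n<) (≤-reflexive (trans (ℕ→ℚ-* (4 ℕ.* I ℕ.* (4 ℕ.* I)) m)
        (cong (λ x → x * ℕ→ℚ m) (ℕ→ℚ-* (4 ℕ.* I) (4 ℕ.* I)))))) s²m≤n

open import Data.Rational using (ℚ; 0ℚ; _+_; _*_; _≤_; _<_)

-- The game against a given online algorithm.

module Play {n m : ℕ} .{{_ : NonZero m}} (A : OnlineAlg n m) where
  import Data.Nat as ℕ
  import Data.Nat.Properties as ℕ
  open import Data.Rational.Properties using (≤-trans; <⇒≤)
  open Counting using (sum)
  open Adversary
  open Rationals

  -- Here `s` ranges over the nonnegative rationals up to the square root of `n / m`, and the ratio
  -- is multiplied by `m * m` to clear denominators. Any feasible `S` suffices, since its flow is at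
  -- least the optimum.
  Beaten : Set
  Beaten = Σ (Instance n) λ J → ValidInstance J ×
           Σ (Schedule n m) λ S → Feasible J S ×
           ((s : ℚ) → 0ℚ ≤ s → s * s * ℕ→ℚ m ≤ ℕ→ℚ n →
            c * (ℕ→ℚ n + ℕ→ℚ m * ℕ→ℚ m * s) * totalFlow J S
              ≤ ℕ→ℚ m * ℕ→ℚ m * totalFlow J (run A J))

  -- For n < 3m the claimed ratio is bounded by a constant, so the algorithm's own
  -- schedule serves as the offline one.
  few-jobs : n ℕ.< 3 ℕ.* m → Beaten
  few-jobs n<3m = J , valid , run A J , feasible A J valid , λ s _ s²m≤n →
      competitive {n} {m} {1} n≤ n< {totalFlow J (run A J)} {totalFlow J (run A J)} 0≤alg 
        (ℕ→ℚ-*-monoˡ-≤ {1} {160} {totalFlow J (run A J)} (ℕ.s≤s ℕ.z≤n) 0≤alg) {s} s²m≤n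
    where
    J : Instance n
    J = integral (λ _ → 0) (λ _ → 1)
    valid : ValidInstance J
    valid = integral-valid {m = m} (λ _ → 0) (λ _ → 1) (λ _ → ℕ.s≤s ℕ.z≤n)
    0≤alg : 0ℚ ≤ totalFlow J (run A J)
    0≤alg = 0≤totalFlow J (run A J) valid (feasible A J valid)
    n≤ : n ℕ.≤ 4 ℕ.* (m ℕ.* m ℕ.* 1)
    n≤ = ℕ.≤-trans (ℕ.<⇒≤ n<3m) (ℕ.*-mono-≤ (ℕ.n≤1+n 3)
           (ℕ.≤-trans (ℕ.m≤m*n m m) (ℕ.m≤m*n (m ℕ.* m) 1)))
    n< : n ℕ.< (4 ℕ.* 1) ℕ.* (4 ℕ.* 1) ℕ.* m
    n< = ℕ.<-≤-trans n<3m (ℕ.*-monoˡ-≤ m (ℕ.m≤m+n 3 13))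

  module _ (params : Parameters n m) where
    open Parameters params

    r : ℕ → Fin n → ℕ
    r τ j = releaseTime m τ (toℕ j)

    p : Fin n → ℕ
    p j = procTime m k (toℕ j)

    J : ℕ → Instance n
    J τ = integral (r τ) p

    valid : ∀ τ → ValidInstance (J τ)
    valid τ = integral-valid {m = m} (r τ) p 0<p
      where
      0<p : ∀ j → 0 ℕ.< p j
      0<p j with toℕ j ℕ.<? m
      ... | yes _ = ℕ.≤-trans (ℕ.≤-trans (ℕ.s≤s ℕ.z≤n) 2≤k) (ℕ.m≤m+n k _)
      ... | no _  = ℕ.s≤s ℕ.z≤n

    f : ℕ → Fin n → ℕ
    f τ j = ⌊ start (run A (J τ)) j ⌋

    μ : ℕ → Fin n → Fin m
    μ τ = machine (run A (J τ))

    f-feasible : ∀ τ → Feasibleℕ (r τ) p (f τ) (μ τ)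
    f-feasible τ = floor-feasible (r τ) p (run A (J τ)) (feasible A (J τ) (valid τ))

    -- Up to time `τ` both instances show just the big jobs, since their streams begin after `τ` and
    -- after `T ≥ τ`. A floor below `τ` puts the start itself before `τ`.
    f-online : ∀ τ T j → τ ℕ.≤ T → f T j ℕ.< τ → f τ j ≡ f T j
    f-online τ T j τ≤T f<τ = cong ⌊_⌋ (proj₁
        (online A (J τ) (J T) (valid τ) (valid T) (ℕ→ℚ τ) same j (inj₂ started)))
      where
      started : start (run A (J T)) j ≤ ℕ→ℚ τ
      started = ≤-trans (<⇒≤ (<1+⌊⌋ (0≤start (J T) (run A (J T)) (valid T) (feasible A (J T) (valid T)) j))) (ℕ→ℚ-mono-≤ f<τ)
      unreleased : ∀ {i t} → τ ℕ.≤ t → ¬ toℕ i ℕ.< m → ¬ ℕ→ℚ (r t i) ≤ ℕ→ℚ τ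
      unreleased {i} {t} τ≤t i≮m r≤τ = ℕ.<⇒≱ (ℕ.≤-<-trans τ≤t (τ<releaseTime-small {m} {t} i≮m)) (ℕ→ℚ-cancel-≤ {r t i} {τ} r≤τ)
      same : ∀ i → ℕ→ℚ (r τ i) ≤ ℕ→ℚ τ ⊎ ℕ→ℚ (r T i) ≤ ℕ→ℚ τ → J τ i ≡ J T i
      same i released = cases (toℕ i ℕ.<? m) released
        where
        cases : Dec (toℕ i ℕ.< m) → ℕ→ℚ (r τ i) ≤ ℕ→ℚ τ ⊎ ℕ→ℚ (r T i) ≤ ℕ→ℚ τ → J τ i ≡ J T i
        cases (yes i<m) _ = cong (λ t → job (ℕ→ℚ t) (ℕ→ℚ (p i)))
          (trans (releaseTime-big {m} {τ} i<m) (sym (releaseTime-big {m} {T} i<m)))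
        cases (no i≮m) (inj₁ r≤τ) = contradiction r≤τ (unreleased ℕ.≤-refl i≮m)
        cases (no i≮m) (inj₂ r≤τ) = contradiction r≤τ (unreleased τ≤T i≮m)

    beaten-by : (∃ λ τ → ∃ λ B → Response.Lost params f μ f-feasible f-online τ B) → Beaten
    beaten-by (τ , B , separated , bound) = J τ , valid τ , S , S-feasible , λ x _ x²m≤n →
        competitive {n} {m} {ratio} n≤4m²ratio n<[4ratio]²m
          {totalFlow (J τ) S} {totalFlow (J τ) (run A (J τ))} (0≤totalFlow (J τ) S (valid τ) S-feasible) scaled {x} x²m≤n
      where
      offline = Offline.offline-feasible {k = k} separated
      s : Fin n → ℕ
      s j = offlineStart m B τ (toℕ j)
      S : Schedule n m
      S = sched (roundRobin m) (ℕ→ℚ ∘ s)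
      S-feasible : Feasible (J τ) S
      S-feasible = embed-feasible (r τ) p s (roundRobin m) offline
      opt = m ℕ.* (B ℕ.+ 2 ℕ.* k) ℕ.+ n
      opt-bound : totalFlow (J τ) S ≤ ℕ→ℚ opt
      opt-bound = ≤-trans (totalFlow-embed (r τ) p s (roundRobin m) offline)
        (ℕ→ℚ-mono-≤ (Offline.total-flow {k = k} separated (ℕ.≤-trans (ℕ.m≤m*n m (suc k)) fits)))
      delay = sum (λ j → f τ j ℕ.∸ r τ j)
      alg-bound : ℕ→ℚ delay ≤ totalFlow (J τ) (run A (J τ))
      alg-bound = totalFlow-lower (J τ) (run A (J τ)) (valid τ) (feasible A (J τ) (valid τ)) (r τ) (λ _ → refl)
        (Feasibleℕ.released (f-feasible τ))
      scaled : ℕ→ℚ ratio * totalFlow (J τ) S ≤ ℕ→ℚ 160 * totalFlow (J τ) (run A (J τ))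
      scaled = ℕ→ℚ-*-sandwich {ratio} {160} {opt} {delay} opt-bound alg-bound bound

    many-jobs : Beaten
    many-jobs = beaten-by (Response.lost params f μ f-feasible f-online)

  beaten : Dec (3 ℕ.* m ℕ.≤ n) → Beaten
  beaten (yes 3m≤n) = many-jobs (Adversary.parameters n m 3m≤n)
  beaten (no 3m≰n)  = few-jobs (ℕ.≰⇒> 3m≰n)

mainTheorem6 : Σ ℚ λ c → (0ℚ < c) ×
    ((n m : ℕ) → n ≥ 1 → m ≥ 1 → (A : OnlineAlg n m) →
    Σ (Instance n) λ J → ValidInstance J ×
    Σ (Schedule n m) λ S → Feasible J S ×
    ((s : ℚ) → 0ℚ ≤ s → s * s * ℕ→ℚ m ≤ ℕ→ℚ n →
    c * (ℕ→ℚ n + ℕ→ℚ m * ℕ→ℚ m * s) * totalFlow J S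
    ≤ ℕ→ℚ m * ℕ→ℚ m * totalFlow J (run A J)))
mainTheorem6 = Rationals.c , positive⁻¹ Rationals.c , λ { n (suc m) _ _ A → Play.beaten A (3 ℕ.* suc m ℕ.≤? n) }
  where
  import Data.Nat as ℕ
  open import Data.Rational.Properties using (positive⁻¹)
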